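{- For every simple signature $\Omega:\mathsf{Con}$, the term algebra $\mathsf{TmAlg}_\Omega:\mathsf{Alg}\,\Omega$ supports recursion and induction: (i) for every $\gamma:\mathsf{Alg}\,\Omega$ there is an algebra morphism in $\mathsf{Mor}\,\mathsf{TmAlg}_\Omega\,\gamma$ (i.e. $\mathsf{TmAlg}_\Omega$ is weakly initial); and (ii) for every displayed algebra $\gamma^D:\mathsf{DispAlg}\,\mathsf{TmAlg}_\Omega$ there is a section in $\mathsf{Section}\,\mathsf{TmAlg}_\Omega\,\gamma^D$.
   Context: The metatheory is an intensional type theory with $\Pi,\Sigma$, unit, intensional identity $=$, inductive families, and universes $\mathsf{Set}:\mathsf{Set}_1$. **Signatures (inductively defined).** Types: $\mathsf{Ty}$ generated by $\iota$ and $\iota\to A$ for $A:\mathsf{Ty}$. Contexts $\mathsf{Con}$ (signatures): lists of types, generated by $\bullet$ and $\Gamma\triangleright A$. Variables $\mathsf{Var}\,\Gamma\,A$: generated by $\mathsf{vz}:\mathsf{Var}\,(\Gamma\triangleright A)\,A$ and $\mathsf{vs}:\mathsf{Var}\,\Gamma\,A\to\mathsf{Var}\,(\Gamma\triangleright B)\,A$. Terms $\mathsf{Tm}\,\Gamma\,A$: generated by $\mathsf{var}:\mathsf{Var}\,\Gamma\,A\to\mathsf{Tm}\,\Gamma\,A$ and $\mathsf{app}:\mathsf{Tm}\,\Gamma\,(\iota\to A)\to\mathsf{Tm}\,\Gamma\,\iota\to\mathsf{Tm}\,\Gamma\,A$. Substitutions: $\mathsf{Sub}\,\Gamma\,\Delta:\equiv\{A:\mathsf{Ty}\}\to\mathsf{Var}\,\Delta\,A\to\mathsf{Tm}\,\Gamma\,A$,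 with $\mathsf{id}:\equiv\mathsf{var}$. **Algebras.** For $X:\mathsf{Set}$: $\iota^A\,X:\equiv X$, $(\iota\to A)^A\,X:\equiv X\to A^A\,X$; $\Gamma^A\,X:\equiv\{A:\mathsf{Ty}\}\to\mathsf{Var}\,\Gamma\,A\to A^A\,X$. $\mathsf{Alg}\,\Gamma:\equiv(X:\mathsf{Set})\times\Gamma^A\,X$. **Morphisms.** For $X^M:X_0\to X_1$: $\iota^M\,X^M\,\alpha_0\,\alpha_1:\equiv(X^M\,\alpha_0=\alpha_1)$; $(\iota\to A)^M\,X^M\,\alpha_0\,\alpha_1:\equiv(x:X_0)\to A^M\,X^M\,(\alpha_0\,x)\,(\alpha_1\,(X^M\,x))$; $\Gamma^M\,X^M\,\gamma_0\,\gamma_1:\equiv\{A\}(x:\mathsf{Var}\,\Gamma\,A)\to A^M\,X^M\,(\gamma_0\,x)\,(\gamma_1\,x)$. $\mathsf{Mor}\,(X_0,\gamma_0)\,(X_1,\gamma_1):\equiv(X^M:X_0\to X_1)\times\Gamma^M\,X^M\,\gamma_0\,\gamma_1$. **Displayed algebras.** For $X^D:X\to\mathsf{Set}$: $\iota^D\,X^D\,\alpha:\equiv X^D\,\alpha$; $(\iota\to A)^D\,X^D\,\alpha:\equiv(x:X)(x^D:X^D\,x)\to A^D\,X^D\,(\alpha\,x)$; $\Gamma^D\,X^D\,\gamma:\equiv\{A\}(x:\mathsf{Var}\,\Gamma\,A)\to A^D\,X^D\,(\gamma\,x)$. $\mathsf{DispAlg}\,(X,\gamma):\equiv(X^D:X\to\mathsf{Set})\times\Gamma^D\,X^D\,\gamma$.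 **Sections.** For $X^S:(x:X)\to X^D\,x$: $\iota^S\,X^S\,\alpha\,\alpha^D:\equiv(X^S\,\alpha=\alpha^D)$; $(\iota\to A)^S\,X^S\,\alpha\,\alpha^D:\equiv(x:X)\to A^S\,X^S\,(\alpha\,x)\,(\alpha^D\,x\,(X^S\,x))$; $\Gamma^S\,X^S\,\gamma\,\gamma^D:\equiv\{A\}(x:\mathsf{Var}\,\Gamma\,A)\to A^S\,X^S\,(\gamma\,x)\,(\gamma^D\,x)$. $\mathsf{Section}\,(X,\gamma)\,(X^D,\gamma^D):\equiv(X^S:(x:X)\to X^D\,x)\times\Gamma^S\,X^S\,\gamma\,\gamma^D$. **Term algebra.** Fix $\Omega:\mathsf{Con}$ and let $\mathsf T:\equiv\mathsf{Tm}\,\Omega\,\iota$. Define $A^T:\mathsf{Tm}\,\Omega\,A\to A^A\,\mathsf T$ by $\iota^T\,t:\equiv t$, $(\iota\to A)^T\,t:\equiv\lambda u.\,A^T\,(\mathsf{app}\,t\,u)$, and $\Gamma^T:\mathsf{Sub}\,\Omega\,\Gamma\to\Gamma^A\,\mathsf T$ by $\Gamma^T\,\nu\,x:\equiv A^T\,(\nu\,x)$ for $x:\mathsf{Var}\,\Gamma\,A$. Then $\mathsf{TmAlg}_\Omega:\equiv(\mathsf T,\ \Omega^T\,\mathsf{id})$. -}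

module Defs where

open import Data.Product using (Σ; _,_)
open import Relation.Binary.PropositionalEquality using (_≡_)

infixr 8 ι⇒_
infixl 5 _▹_

-- ι⇒ A is the type ι → A; domains are always ι.
data Ty : Set where
  ι   : Ty
  ι⇒_ : Ty → Ty

data Con : Set where
  ∙   : Con
  _▹_ : Con → Ty → Con

data Var : Con → Ty → Set where
  vz : ∀ {Γ A} → Var (Γ ▹ A) A
  vs : ∀ {Γ A B} → Var Γ A → Var (Γ ▹ B) A

data Tm (Γ : Con) : Ty → Set where
  var : ∀ {A} → Var Γ A → Tm Γ A
  app : ∀ {A} → Tm Γ (ι⇒ A) → Tm Γ ι → Tm Γ A

Sub : Con → Con → Set
Sub Γ Δ = {A : Ty} → Var Δ A → Tm Γ A

id : ∀ {Γ} → Sub Γ Γ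
id = var

-- Superscripts: ᴬ algebras, ᴹ morphisms, ᴰ displayed algebras,
-- ˢ sections, ᵀ term algebra.

Tyᴬ : Ty → Set → Set
Tyᴬ ι      X = X
Tyᴬ (ι⇒ A) X = X → Tyᴬ A X

Conᴬ : Con → Set → Set
Conᴬ Γ X = {A : Ty} → Var Γ A → Tyᴬ A X

Alg : Con → Set₁
Alg Γ = Σ Set (λ X → Conᴬ Γ X)

Tyᴹ : (A : Ty) {X₀ X₁ : Set} (Xᴹ : X₀ → X₁) → Tyᴬ A X₀ → Tyᴬ A X₁ → Set
Tyᴹ ι      Xᴹ α₀ α₁ = Xᴹ α₀ ≡ α₁
Tyᴹ (ι⇒ A) Xᴹ α₀ α₁ = ∀ x → Tyᴹ A Xᴹ (α₀ x) (α₁ (Xᴹ x))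

Conᴹ : (Γ : Con) {X₀ X₁ : Set} (Xᴹ : X₀ → X₁) → Conᴬ Γ X₀ → Conᴬ Γ X₁ → Set
Conᴹ Γ Xᴹ γ₀ γ₁ = {A : Ty} (x : Var Γ A) → Tyᴹ A Xᴹ (γ₀ x) (γ₁ x)

Mor : ∀ {Γ} → Alg Γ → Alg Γ → Set
Mor {Γ} (X₀ , γ₀) (X₁ , γ₁) = Σ (X₀ → X₁) (λ Xᴹ → Conᴹ Γ Xᴹ γ₀ γ₁)

Tyᴰ : (A : Ty) {X : Set} (Xᴰ : X → Set) → Tyᴬ A X → Set
Tyᴰ ι      Xᴰ α = Xᴰ α
Tyᴰ (ι⇒ A) Xᴰ α = ∀ x → Xᴰ x → Tyᴰ A Xᴰ (α x)

Conᴰ : (Γ : Con) {X : Set} (Xᴰ : X → Set) → Conᴬ Γ X → Set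
Conᴰ Γ Xᴰ γ = {A : Ty} (x : Var Γ A) → Tyᴰ A Xᴰ (γ x)

DispAlg : ∀ {Γ} → Alg Γ → Set₁
DispAlg {Γ} (X , γ) = Σ (X → Set) (λ Xᴰ → Conᴰ Γ Xᴰ γ)

Tyˢ : (A : Ty) {X : Set} {Xᴰ : X → Set} (Xˢ : ∀ x → Xᴰ x) →
      (α : Tyᴬ A X) → Tyᴰ A Xᴰ α → Set
Tyˢ ι      Xˢ α αᴰ = Xˢ α ≡ αᴰ
Tyˢ (ι⇒ A) Xˢ α αᴰ = ∀ x → Tyˢ A Xˢ (α x) (αᴰ x (Xˢ x))

Conˢ : (Γ : Con) {X : Set} {Xᴰ : X → Set} (Xˢ : ∀ x → Xᴰ x) →
       (γ : Conᴬ Γ X) → Conᴰ Γ Xᴰ γ → Set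
Conˢ Γ Xˢ γ γᴰ = {A : Ty} (x : Var Γ A) → Tyˢ A Xˢ (γ x) (γᴰ x)

Section : ∀ {Γ} (γ : Alg Γ) → DispAlg γ → Set
Section {Γ} (X , γ) (Xᴰ , γᴰ) = Σ (∀ x → Xᴰ x) (λ Xˢ → Conˢ Γ Xˢ γ γᴰ)

Tyᵀ : ∀ {Ω} (A : Ty) → Tm Ω A → Tyᴬ A (Tm Ω ι)
Tyᵀ ι      t = t
Tyᵀ (ι⇒ A) t = λ u → Tyᵀ A (app t u)

Conᵀ : ∀ {Ω} (Γ : Con) → Sub Ω Γ → Conᴬ Γ (Tm Ω ι)
Conᵀ Γ ν {A} x = Tyᵀ A (ν x)

TmAlg : (Ω : Con) → Alg Ω
TmAlg Ω = Tm Ω ι , Conᵀ Ω id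

{-# OPTIONS --safe #-}
-- Evaluate terms of every type, not only of type ι: an algebra interprets t : Tm Ω A
-- in Tyᴬ A X, and a displayed algebra interprets it over Tyᵀ A t. Evaluation computes
-- on app, so the morphism and section equations reduce by induction on A to refl at ι.
module Submission where

open import Defs
open import Data.Product using (_×_; _,_)
open import Relation.Binary.PropositionalEquality using (refl)

module _ {Ω : Con} {X : Set} (γ : Conᴬ Ω X) where

  rec : ∀ {A} → Tm Ω A → Tyᴬ A X
  rec (var x)   = γ x
  rec (app t u) = rec t (rec u)

  -- Stated for all terms, not only variables, because the case `ι⇒ A` passes from `t` to `app t u`.
  rec-Tyᴹ : ∀ A (t : Tm Ω A) → Tyᴹ A rec (Tyᵀ A t) (rec t)
  rec-Tyᴹ ι      t = refl
  rec-Tyᴹ (ι⇒ A) t = λ u → rec-Tyᴹ A (app t u)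

module _ {Ω : Con} {Xᴰ : Tm Ω ι → Set} (γᴰ : Conᴰ Ω Xᴰ (Conᵀ Ω id)) where

  elim : ∀ {A} (t : Tm Ω A) → Tyᴰ A Xᴰ (Tyᵀ A t)
  elim (var x)   = γᴰ x
  -- No transport: `Tyᵀ (ι⇒ A) t u` is `Tyᵀ A (app t u)` by definition, and `Tyᵀ ι u` is `u`.
  elim (app t u) = elim t u (elim u)

  elim-Tyˢ : ∀ A (t : Tm Ω A) → Tyˢ A elim (Tyᵀ A t) (elim t)
  elim-Tyˢ ι      t = refl
  elim-Tyˢ (ι⇒ A) t = λ u → elim-Tyˢ A (app t u)

mainTheorem11 : (Ω : Con) →
    ((γ : Alg Ω) → Mor (TmAlg Ω) γ) × ((γᴰ : DispAlg (TmAlg Ω)) → Section (TmAlg Ω) γᴰ)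
mainTheorem11 Ω =
    -- At `var x` the term algebra's operation is `Tyᵀ A (var x)` and `rec` returns `γ x`, so the
    -- lemma is the required equation.
    (λ (X , γ) → rec γ , λ {A} x → rec-Tyᴹ γ A (var x))
  , (λ (Xᴰ , γᴰ) → elim γᴰ , λ {A} x → elim-Tyˢ γᴰ A (var x))
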